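{- Let $P$ be a lower-L-bounded or upper-L-bounded poset. Then the limit $\pi(P)=\lim_{n\to\infty}\mathrm{La}(n,P)/\binom{n}{\lfloor n/2\rfloor}$ exists and $\pi(P)=e(P)$.
   Context: All posets are finite and nonempty. Let $[n]=\{1,\dots,n\}$; families of subsets of $[n]$ are ordered by inclusion. A poset $(P,\le)$ contains a poset $(P',\le')$ as a (weak) subposet if there is an injection $f:P'\to P$ such that $u\le' v$ implies $f(u)\le f(v)$. A family $\mathcal F\subseteq 2^{[n]}$ is $P$-free if it does not contain $P$ in this sense. $\mathrm{La}(n,P)$ is the largest size of a $P$-free family $\mathcal F\subseteq 2^{[n]}$. $e(P)$ is the maximum integer $k\ge 0$ such that for all integers $n$ and $s$ the family $\binom{[n]}{s}\cup\binom{[n]}{s+1}\cup\cdots\cup\binom{[n]}{s+k-1}$ is $P$-free, where $\binom{[n]}{j}$ is the collection of $j$-element subsets of $[n]$ (empty if $j<0$ or $j>n$). The Lubell function of $\mathcal F\subseteq 2^{[n]}$ is the average over all $n!$ full (maximal) chains $\mathcal C$ of $2^{[n]}$ of $|\mathcal F\cap\mathcal C|$; equivalently $\bar h_n(\mathcal F)=\sum_{F\in\mathcal F}1/\binom{n}{|F|}$. $P$ is lower-L-bounded if for any $\beta\in(\frac12,1)$ and $\varepsilon>0$ there exists $N=N(\beta,\varepsilon)$ such that for all $n\ge N$, $\bar h_n(\mathcal F)\le e(P)+\varepsilon$ for all $P$-free families $\mathcal F$ of subsets of $[n]$ of sizes less than $\beta n$. $P$ is upper-L-bounded if for any $\alpha\in(0,\frac12)$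 and $\varepsilon>0$ there exists $N=N(\alpha,\varepsilon)$ such that for all $n\ge N$, $\bar h_n(\mathcal F)\le e(P)+\varepsilon$ for all $P$-free families $\mathcal F$ of subsets of $[n]$ of sizes greater than $\alpha n$. -}

module Defs where

open import Data.Bool.Base using (Bool)
open import Data.Bool.Properties using () renaming (_≟_ to _≟ᵇ_)
open import Data.Empty using (⊥; ⊥-elim)
open import Data.Fin.Base using (Fin; zero; suc; combine)
open import Data.Fin.Properties using (all?; combine-injective; injective⇒≤)
  renaming (_≟_ to _≟ᶠ_)
open import Data.Fin.Subset using (Subset; _⊆_; ∣_∣) renaming (_∈_ to _∈ˢ_)
open import Data.Fin.Subset.Properties using (anySubset?; _⊆?_; ∣p∣≤n)
open import Data.Integer.Base as ℤ using (ℤ; +_)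
open import Data.List.Base using (List; []; _∷_; length; map; foldr; lookup)
open import Data.List.Membership.Propositional using () renaming (_∈_ to _∈ˡ_)
open import Data.List.Relation.Unary.All as All using (All; []; _∷_)
open import Data.List.Relation.Unary.AllPairs using ([]; _∷_)
open import Data.List.Relation.Unary.Unique.Propositional using (Unique)
open import Data.List.Membership.Propositional.Properties using (∈-lookup)
open import Data.Nat.Base as ℕ using (ℕ; zero; suc; _^_; _!; _∸_; ⌊_/2⌋; NonZero)
open import Data.Nat.Combinatorics using (_C_; nCk≡n!/k![n-k]!; [n∸k]!k!∣n!)
open import Data.Nat.Divisibility using (_∣_; ∣⇒≤)
open import Data.Nat.DivMod using (m≥n⇒m/n>0)
open import Data.Nat.Properties as ℕₚ using (_!≢0; _!*_!≢0; ⌊n/2⌋≤n)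
open import Data.Product.Base using (∃; ∃-syntax; _×_; _,_; proj₁; proj₂)
open import Data.Rational.Base as ℚ using (ℚ; 0ℚ; 1ℚ; ½; _/_)
open import Data.Vec.Base using ([]; _∷_)
open import Data.Vec.Properties using (≡-dec)
open import Function.Base using (_∘_)
open import Function.Definitions using (Injective)
open import Level using (0ℓ)
open import Relation.Binary.Core using (Rel; _=[_]⇒_)
open import Relation.Binary.PropositionalEquality
  using (_≡_; _≗_; refl; sym; trans; cong; cong₂; subst)
open import Relation.Binary.Structures using (IsDecPartialOrder)
open import Relation.Nullary.Decidable using (Dec; yes; no; ¬?; map′; _×-dec_; _→-dec_)
open import Relation.Nullary.Negation using (¬_)
open import Relation.Unary using (Pred; Decidable; _∈_)
import Data.List.Membership.DecPropositional as DecMembership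
import Data.List.Relation.Unary.Unique.DecPropositional as DecUnique

-- Every finite poset is isomorphic to one whose elements are labelled by
-- Fin card.

record FinPoset : Set₁ where
  infix 4 _≼_
  field
    card              : ℕ
    card-nonZero      : NonZero card
    _≼_               : Rel (Fin card) 0ℓ
    isDecPartialOrder : IsDecPartialOrder _≡_ _≼_

  open IsDecPartialOrder isDecPartialOrder public
    using () renaming (_≤?_ to _≼?_)

-- Weak embeddings: order is preserved but need not be reflected.

IsWeakEmbedding : ∀ (P : FinPoset) {n} → Pred (Subset n) 0ℓ →
                  (Fin (FinPoset.card P) → Subset n) → Set
IsWeakEmbedding P 𝓕 f = (∀ u → f u ∈ 𝓕) × Injective _≡_ _≡_ f × _≼_ =[ f ]⇒ _⊆_
  where open FinPoset P

Contains : ∀ {n} → Pred (Subset n) 0ℓ → FinPoset → Set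
Contains 𝓕 P = ∃ (IsWeakEmbedding P 𝓕)

_-Free : FinPoset → ∀ {n} → Pred (Subset n) 0ℓ → Set
(P -Free) 𝓕 = ¬ Contains 𝓕 P

-- Families whose cardinality or Lubell function is taken are listed without
-- repetition.

record Family (n : ℕ) : Set where
  constructor family
  field
    members : List (Subset n)
    unique  : Unique members

open Family public

⟦_⟧ : ∀ {n} → Family n → Pred (Subset n) 0ℓ
⟦ 𝓕 ⟧ A = A ∈ˡ members 𝓕

#_ : ∀ {n} → Family n → ℕ
# 𝓕 = length (members 𝓕)

IsMaximum : Pred ℕ 0ℓ → ℕ → Set
IsMaximum Q m = Q m × (∀ k → Q k → k ℕ.≤ m)

-- The sets of sizes s, s+1, …, s+k-1; s ranges over ℤ, so some of these
-- levels may be empty.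

Levels : ∀ n → ℤ → ℕ → Pred (Subset n) 0ℓ
Levels n s k A = s ℤ.≤ + ∣ A ∣ × + ∣ A ∣ ℤ.< s ℤ.+ + k

-- e Is-e-Of P  says  e = e(P).  At most one e qualifies.  It is a relation and
-- not a function because the property being maximised quantifies over
-- infinitely many n and s, so it cannot be searched exhaustively as for La.

_Is-e-Of_ : ℕ → FinPoset → Set
e Is-e-Of P = IsMaximum (λ k → ∀ n s → (P -Free) (Levels n s k)) e

FreeFamilyOfSize : FinPoset → ℕ → ℕ → Set
FreeFamilyOfSize P n m = ∃[ 𝓕 ] ((P -Free) {n} ⟦ 𝓕 ⟧ × # 𝓕 ≡ m)

-- La P n is the maximum m with FreeFamilyOfSize P n m, found by exhaustive
-- search up to 2 ^ n.

private
  maximum : ∀ {Q : Pred ℕ 0ℓ} → Decidable Q → Q 0 →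
            ∀ b → (∀ k → Q k → k ℕ.≤ b) → ∃ (IsMaximum Q)
  maximum Q? q₀ zero    bd = 0 , q₀ , bd
  maximum {Q} Q? q₀ (suc b) bd with Q? (suc b)
  ... | yes q = suc b , q , bd
  ... | no ¬q = maximum Q? q₀ b
    λ k q → ℕₚ.≤-pred (ℕₚ.≤∧≢⇒< (bd k q) λ { refl → ¬q q })

  anyMap? : ∀ p {n} {Q : (Fin p → Subset n) → Set} →
            (∀ {f g} → f ≗ g → Q f → Q g) → (∀ f → Dec (Q f)) → Dec (∃ Q)
  anyMap? zero    resp Q? = map′ (_ ,_) (λ (_ , q) → resp (λ ()) q) (Q? λ ())
  anyMap? (suc p) {n} {Q} resp Q? =
    map′ (λ (A , g , q) → cons A g , q)
         (λ (f , q) → f zero , f ∘ suc , resp (λ { zero → refl ; (suc _) → refl }) q)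
         (anySubset? λ A → anyMap? p
           (λ f≗g → resp λ { zero → refl ; (suc i) → f≗g i }) (Q? ∘ cons A))
    where
    cons : Subset n → (Fin p → Subset n) → Fin (suc p) → Subset n
    cons A g zero    = A
    cons A g (suc i) = g i

  anyList? : ∀ m {n} {Q : List (Subset n) → Set} → (∀ xs → Dec (Q xs)) →
             Dec (∃[ xs ] (Q xs × length xs ≡ m))
  anyList? zero    Q? = map′ (λ q → [] , q , refl) (λ { ([] , q , _) → q }) (Q? [])
  anyList? (suc m) Q? =
    map′ (λ (A , xs , q , eq) → A ∷ xs , q , cong suc eq)
         (λ { (A ∷ xs , q , eq) → A , xs , q , ℕₚ.suc-injective eq })
         (anySubset? λ A → anyList? m (Q? ∘ (A ∷_)))

  _≟ˢ_ : ∀ {n} (A B : Subset n) → Dec (A ≡ B)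
  _≟ˢ_ = ≡-dec _≟ᵇ_

  module _ (P : FinPoset) where
    open FinPoset P

    contains? : ∀ {n} {𝓕 : Pred (Subset n) 0ℓ} → Decidable 𝓕 → Dec (Contains 𝓕 P)
    contains? {n} {𝓕} 𝓕? = anyMap? card resp embedding?
      where
      resp : ∀ {f g} → f ≗ g → IsWeakEmbedding P 𝓕 f → IsWeakEmbedding P 𝓕 g
      resp f≗g (mem , inj , mono) =
          (λ u → subst 𝓕 (f≗g u) (mem u))
        , (λ {u} {v} eq → inj (trans (f≗g u) (trans eq (sym (f≗g v)))))
        , (λ {u} {v} u≼v {x} →
            subst (λ T → T) (cong₂ (λ A B → x ∈ˢ A → x ∈ˢ B) (f≗g u) (f≗g v)) (mono u≼v))

      embedding? : ∀ f → Dec (IsWeakEmbedding P 𝓕 f)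
      embedding? f = all? (𝓕? ∘ f) ×-dec
        map′ (λ h {u} {v} → h u v) (λ h u v → h {u} {v})
          (all? λ u → all? λ v → (f u ≟ˢ f v) →-dec (u ≟ᶠ v)) ×-dec
        map′ (λ h {u} {v} → h u v) (λ h u v → h {u} {v})
          (all? λ u → all? λ v → (u ≼? v) →-dec (f u ⊆? f v))

    freeFamilyOfSize? : ∀ n m → Dec (FreeFamilyOfSize P n m)
    freeFamilyOfSize? n m =
      map′ (λ (xs , (u , fr) , eq) → family xs u , fr , eq)
           (λ (family xs u , fr , eq) → xs , (u , fr) , eq)
           (anyList? m λ xs → DecUnique.unique? _≟ˢ_ xs ×-dec
             ¬? (contains? λ A → DecMembership._∈?_ _≟ˢ_ A xs))

    freeFamilyOfSize-0 : ∀ n → FreeFamilyOfSize P n 0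
    freeFamilyOfSize-0 n =
      family [] [] , (λ (f , mem , _) → noElem card-nonZero (λ u → ∉[] (mem u))) , refl
      where
      ∉[] : ∀ {A : Subset n} → ¬ (A ∈ˡ [])
      ∉[] ()
      noElem : ∀ {c} → NonZero c → ¬ (Fin c → ⊥)
      noElem {suc _} _ h = h zero

  bit : Bool → Fin 2
  bit Bool.false = zero
  bit Bool.true  = suc zero

  bit-injective : ∀ {a b} → bit a ≡ bit b → a ≡ b
  bit-injective {Bool.false} {Bool.false} _ = refl
  bit-injective {Bool.true}  {Bool.true}  _ = refl

  code : ∀ {n} → Subset n → Fin (2 ^ n)
  code []      = zero
  code (b ∷ A) = combine (bit b) (code A)

  code-injective : ∀ {n} {A B : Subset n} → code A ≡ code B → A ≡ B
  code-injective {A = []}    {[]}    _  = refl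
  code-injective {A = a ∷ A} {b ∷ B} eq =
    let p , q = combine-injective (bit a) (code A) (bit b) (code B) eq
    in cong₂ _∷_ (bit-injective p) (code-injective q)

  lookup-injective : ∀ {A : Set} {xs : List A} → Unique xs → Injective _≡_ _≡_ (lookup xs)
  lookup-injective (x∉ ∷ u) {zero}  {zero}  _  = refl
  lookup-injective (x∉ ∷ u) {zero}  {suc j} eq = ⊥-elim (All.lookup x∉ (∈-lookup j) eq)
  lookup-injective (x∉ ∷ u) {suc i} {zero}  eq = ⊥-elim (All.lookup x∉ (∈-lookup i) (sym eq))
  lookup-injective (x∉ ∷ u) {suc i} {suc j} eq = cong suc (lookup-injective u eq)

#≤2^n : ∀ {n} (𝓕 : Family n) → # 𝓕 ℕ.≤ 2 ^ n
#≤2^n 𝓕 = injective⇒≤ {f = code ∘ lookup (members 𝓕)}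
  (lookup-injective (unique 𝓕) ∘ code-injective)

La-maximum : ∀ P n → ∃ (IsMaximum (FreeFamilyOfSize P n))
La-maximum P n = maximum (freeFamilyOfSize? P n) (freeFamilyOfSize-0 P n) (2 ^ n)
  λ { _ (𝓕 , _ , refl) → #≤2^n 𝓕 }

La : FinPoset → ℕ → ℕ
La P n = proj₁ (La-maximum P n)

La-isMaximum : ∀ P n → IsMaximum (FreeFamilyOfSize P n) (La P n)
La-isMaximum P n = proj₂ (La-maximum P n)

nCk-nonZero : ∀ {n k} → k ℕ.≤ n → NonZero (n C k)
nCk-nonZero {n} {k} k≤n = ℕ.>-nonZero (subst (0 ℕ.<_) (sym (nCk≡n!/k![n-k]! k≤n))
  (m≥n⇒m/n>0 (∣⇒≤ (subst (_∣ n !) (ℕₚ.*-comm ((n ∸ k) !) (k !)) ([n∸k]!k!∣n! k≤n)))))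
  where
  instance
    _ = k !* (n ∸ k) !≢0
    _ = n !≢0

fromℕ : ℕ → ℚ
fromℕ m = + m / 1

-- The average of |𝓕 ∩ 𝓒| over the n ! full chains 𝓒, as the sum of
-- 1 / (n C ∣ A ∣), the fraction of full chains through A.

lubell : ∀ {n} → Family n → ℚ
lubell {n} 𝓕 = foldr ℚ._+_ 0ℚ (map weight (members 𝓕))
  where
  weight : Subset n → ℚ
  weight A = (+ 1 / (n C ∣ A ∣)) {{nCk-nonZero (∣p∣≤n A)}}

-- Both parameters may be taken rational: a bound for some β (α) and ε gives
-- the bound for every smaller β (larger α) and every larger ε.

LowerLBounded : FinPoset → Set
LowerLBounded P = ∀ {e} → e Is-e-Of P →
  ∀ β ε → ½ ℚ.< β → β ℚ.< 1ℚ → 0ℚ ℚ.< ε →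
  ∃[ N ] ∀ n → N ℕ.≤ n → (𝓕 : Family n) → (P -Free) ⟦ 𝓕 ⟧ →
    All (λ A → fromℕ ∣ A ∣ ℚ.< β ℚ.* fromℕ n) (members 𝓕) →
    lubell 𝓕 ℚ.≤ fromℕ e ℚ.+ ε

UpperLBounded : FinPoset → Set
UpperLBounded P = ∀ {e} → e Is-e-Of P →
  ∀ α ε → 0ℚ ℚ.< α → α ℚ.< ½ → 0ℚ ℚ.< ε →
  ∃[ N ] ∀ n → N ℕ.≤ n → (𝓕 : Family n) → (P -Free) ⟦ 𝓕 ⟧ →
    All (λ A → α ℚ.* fromℕ n ℚ.< fromℕ ∣ A ∣) (members 𝓕) →
    lubell 𝓕 ℚ.≤ fromℕ e ℚ.+ ε

La-ratio : FinPoset → ℕ → ℚ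
La-ratio P n = (+ La P n / (n C ⌊ n /2⌋)) {{nCk-nonZero (⌊n/2⌋≤n n)}}

_⟶_ : (ℕ → ℚ) → ℚ → Set
a ⟶ ℓ = ∀ ε → 0ℚ ℚ.< ε → ∃[ N ] ∀ n → N ℕ.≤ n → ℚ.∣ a n ℚ.- ℓ ∣ ℚ.< ε

module Submission where

open import Defs
open import Data.Sum.Base using (_⊎_)

open import Data.Bool.Properties using (not-injective)
open import Data.Fin.Subset using (Subset; ∣_∣; inside; outside; ∁)
open import Data.Fin.Subset.Properties using (∣p∣≤n; ∣∁p∣≡n∸∣p∣)
open import Data.Integer.Base as ℤ using (+_)
import Data.Integer.Properties as ℤₚ
open import Data.List.Base using (List; []; _∷_; _++_; [_]; map; length; filter; foldr)
open import Data.List.Membership.Propositional using (_∈_)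
open import Data.List.Membership.Propositional.Properties
  using (∈-++⁺ˡ; ∈-++⁺ʳ; ∈-++⁻; ∈-map⁺; ∈-map⁻; ∈-∃++; ∈-filter⁻)
open import Data.List.Properties using (length-++; length-map)
open import Data.List.Relation.Binary.Subset.Propositional using (_⊆_)
open import Data.List.Relation.Unary.All as All using (All; []; _∷_)
import Data.List.Relation.Unary.All.Properties as Allₚ
open import Data.List.Relation.Unary.AllPairs using ([]; _∷_)
open import Data.List.Relation.Unary.Any using (here; there)
open import Data.List.Relation.Unary.Unique.Propositional using (Unique)
import Data.List.Relation.Unary.Unique.Propositional.Properties as Uniqueₚ
open import Data.Nat.Base
open import Data.Nat.Combinatorics
  using (_C_; k>n⇒nCk≡0; nC1≡n; nCk≡nC[n∸k]; nCk+nC[k+1]≡[n+1]C[k+1])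
open import Data.Nat.DivMod using (m≡m%n+[m/n]*n; m%n<n; m/n*n≤m; /-mono-≤; m*n/n≡m)
open import Data.Nat.Properties
open import Data.Nat.Tactic.RingSolver using (solve-∀)
open import Data.Product.Base using (∃-syntax; _×_; _,_; proj₁; proj₂)
open import Data.Rational.Base as ℚ using (ℚ; mkℚ; 0ℚ; 1ℚ; ½; ↧ₙ_)
import Data.Rational.Properties as ℚₚ
open import Data.Rational.Solver using (module +-*-Solver)
open import Data.Rational.Unnormalised.Base as ℚᵘ using (mkℚᵘ)
import Data.Rational.Unnormalised.Properties as ℚᵘₚ
open import Data.Sum.Base using (inj₁; inj₂)
open import Data.Vec.Base using ([]; _∷_)
open import Data.Vec.Properties using (∷-injectiveˡ; ∷-injectiveʳ)
open import Function.Base using (_∘_)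
open import Level using (0ℓ)
open import Relation.Binary.PropositionalEquality
  using (_≡_; _≢_; refl; sym; trans; cong; cong₂; subst; module ≡-Reasoning)
open import Relation.Nullary.Decidable using (yes; no; ¬?; from-yes; toWitness)
open import Relation.Nullary.Negation using (¬_; contradiction)
open import Relation.Unary using (Pred; Decidable)

-- Write M for the middle binomial coefficient.  The e levels from ⌊n/2⌋ upwards
-- form a P-free family, and since (k+1) C(n,k+1) = (n-k) C(n,k), each of them has
-- at least (1 - O(1/n)) M sets; so La ≥ (e - O(1/n)) M.
-- Conversely, for a P-free family with P lower-L-bounded, cut at size 3n/4: the
-- part below has Lubell function at most e + δ, hence at most (e + δ) M sets,
-- as every set has weight at least 1/M.  The sets of size at least 3n/4 number
-- O(M/n), because binomial coefficients at least halve at every step beyond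
-- 2n/3.  If P is upper-L-bounded, cut at n/4 instead and take complements.

-- Ratios of consecutive binomial coefficients and the largest coefficient.

middle : ℕ → ℕ
middle n = n C ⌊ n /2⌋

-- The identity (k+1) C(n,k+1) = (n-k) C(n,k), rearranged to avoid subtraction so that no hypothesis
-- k ≤ n is required. Pascal's rule reduces the instance at n+1 to two instances at n.
C-absorption : ∀ n k → suc k * (n C suc k) + k * (n C k) ≡ n * (n C k)
C-absorption zero    zero    = refl
C-absorption zero    (suc k) rewrite k>n⇒nCk≡0 {0} {suc k} z<s | k>n⇒nCk≡0 {0} {suc (suc k)} z<s
  | *-zeroʳ k = refl
C-absorption (suc n) zero    = trans (+-identityʳ _) (trans (+-identityʳ _)
  (trans (nC1≡n (suc n)) (sym (*-identityʳ (suc n)))))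
C-absorption (suc n) (suc k) = begin
  suc (suc k) * (suc n C suc (suc k)) + suc k * (suc n C suc k)
    ≡⟨ cong₂ (λ x y → suc (suc k) * x + suc k * y) (pascal (suc k)) (pascal k) ⟨
  suc (suc k) * (c₁ + c₂) + suc k * (c₀ + c₁)
    ≡⟨ regroup k c₀ c₁ c₂ ⟩
  (suc (suc k) * c₂ + suc k * c₁) + (suc k * c₁ + k * c₀) + (c₀ + c₁)
    ≡⟨ cong₂ (λ x y → x + y + (c₀ + c₁)) (C-absorption n (suc k)) (C-absorption n k) ⟩
  n * c₁ + n * c₀ + (c₀ + c₁)
    ≡⟨ collect n c₀ c₁ ⟩
  suc n * (c₀ + c₁)
    ≡⟨ cong (suc n *_) (pascal k) ⟩
  suc n * (suc n C suc k) ∎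
  where
  open ≡-Reasoning
  pascal = nCk+nC[k+1]≡[n+1]C[k+1] n
  c₀ = n C k
  c₁ = n C suc k
  c₂ = n C suc (suc k)
  regroup : ∀ k a b c → suc (suc k) * (b + c) + suc k * (a + b) ≡
    (suc (suc k) * c + suc k * b) + (suc k * b + k * a) + (a + b)
  regroup = solve-∀
  collect : ∀ n a b → n * b + n * a + (a + b) ≡ suc n * (a + b)
  collect = solve-∀

-- The ratio C(n,k+1)/C(n,k) is (n-k)/(k+1), and the hypothesis says that this is at most 1/`t`. The
-- case `t = 1` gives the descent above the middle, `t = 2` the halving in the tail.
C-decreasing : ∀ n t k → t * n ≤ t * k + suc k → t * (n C suc k) ≤ n C k
C-decreasing n t k tn≤ = *-cancelˡ-≤ (suc k) (+-cancelʳ-≤ (t * k * c) _ _ (begin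
  suc k * (t * c′) + t * k * c  ≡⟨ factor t k c c′ ⟩
  t * (suc k * c′ + k * c)      ≡⟨ cong (t *_) (C-absorption n k) ⟩
  t * (n * c)                   ≡⟨ *-assoc t n c ⟨
  t * n * c                     ≤⟨ *-monoˡ-≤ c tn≤ ⟩
  (t * k + suc k) * c           ≡⟨ *-distribʳ-+ c (t * k) (suc k) ⟩
  t * k * c + suc k * c         ≡⟨ +-comm (t * k * c) _ ⟩
  suc k * c + t * k * c         ∎))
  where
  open ≤-Reasoning
  c  = n C k
  c′ = n C suc k
  factor : ∀ t k c c′ → suc k * (t * c′) + t * k * c ≡ t * (suc k * c′ + k * c)
  factor = solve-∀

⌈n/2⌉≤1+⌊n/2⌋ : ∀ n → ⌈ n /2⌉ ≤ suc ⌊ n /2⌋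
⌈n/2⌉≤1+⌊n/2⌋ n = ⌊n/2⌋-mono (n≤1+n (suc n))

C[⌊n/2⌋+i]≤middle : ∀ n i → n C (⌊ n /2⌋ + i) ≤ middle n
C[⌊n/2⌋+i]≤middle n zero    = ≤-reflexive (cong (n C_) (+-identityʳ ⌊ n /2⌋))
C[⌊n/2⌋+i]≤middle n (suc i) = begin
  n C (h + suc i)      ≡⟨ cong (n C_) (+-suc h i) ⟩
  n C suc (h + i)      ≡⟨ *-identityˡ _ ⟨
  1 * (n C suc (h + i))  ≤⟨ C-decreasing n 1 (h + i) n≤ ⟩
  n C (h + i)          ≤⟨ C[⌊n/2⌋+i]≤middle n i ⟩
  middle n             ∎
  where
  open ≤-Reasoning
  h = ⌊ n /2⌋
  -- For `t = 1` the hypothesis of `C-decreasing` at k reads n ≤ 2k+1. It holds from k = ⌊n/2⌋ on,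
  -- for either parity of n.
  n≤ : 1 * n ≤ 1 * (h + i) + suc (h + i)
  n≤ = begin
    1 * n                          ≡⟨ *-identityˡ n ⟩
    n                              ≡⟨ ⌊n/2⌋+⌈n/2⌉≡n n ⟨
    h + ⌈ n /2⌉
      ≤⟨ +-mono-≤ (m≤m+n h i) (≤-trans (⌈n/2⌉≤1+⌊n/2⌋ n) (s≤s (m≤m+n h i))) ⟩
    (h + i) + suc (h + i)          ≡⟨ cong (_+ suc (h + i)) (*-identityˡ (h + i)) ⟨
    1 * (h + i) + suc (h + i)      ∎

nCk≤middle : ∀ n k → n C k ≤ middle n
nCk≤middle n k with ≤-total ⌊ n /2⌋ k
... | inj₁ h≤k = subst (λ j → n C j ≤ middle n) (m+[n∸m]≡n h≤k) (C[⌊n/2⌋+i]≤middle n (k ∸ ⌊ n /2⌋))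
-- Below the middle, the symmetry C(n,k) = C(n,n-k) reflects k into the upper half.
... | inj₂ k≤h = begin
  n C k                          ≡⟨ nCk≡nC[n∸k] (≤-trans k≤h (⌊n/2⌋≤n n)) ⟩
  n C (n ∸ k)                    ≡⟨ cong (n C_) (m+[n∸m]≡n h≤n∸k) ⟨
  n C (⌊ n /2⌋ + (n ∸ k ∸ ⌊ n /2⌋)) ≤⟨ C[⌊n/2⌋+i]≤middle n _ ⟩
  middle n                       ∎
  where
  open ≤-Reasoning
  h≤n∸k : ⌊ n /2⌋ ≤ n ∸ k
  h≤n∸k = begin
    ⌊ n /2⌋          ≤⟨ ⌊n/2⌋≤⌈n/2⌉ n ⟩
    ⌈ n /2⌉          ≡⟨ n∸⌊n/2⌋≡⌈n/2⌉ ⟨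
    n ∸ ⌊ n /2⌋      ≤⟨ ∸-monoʳ-≤ n k≤h ⟩
    n ∸ k            ∎
    where
    n∸⌊n/2⌋≡⌈n/2⌉ : n ∸ ⌊ n /2⌋ ≡ ⌈ n /2⌉
    n∸⌊n/2⌋≡⌈n/2⌉ = trans (cong (_∸ ⌊ n /2⌋) (sym (⌊n/2⌋+⌈n/2⌉≡n n))) (m+n∸m≡n ⌊ n /2⌋ ⌈ n /2⌉)

-- Levels just above the middle.

-- Absorption together with 2h ≤ n gives (h+i+1) c′ + (h+i) c ≥ 2hc. Adding c and cancelling hc
-- leaves (h+1) c ≤ (h+1) c′ + i c′ + (i+1) c, where the last two terms are at most (2i+1) M.
C-step-loss : ∀ n i → let h = ⌊ n /2⌋ in
  suc h * (n C (h + i)) ≤ suc h * (n C (h + suc i)) + (i + suc i) * middle n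
C-step-loss n i = +-cancelʳ-≤ (h * c) _ _ (begin
  suc h * c + h * c                                 ≡⟨ double h c ⟩
  (h + h) * c + c                                   ≤⟨ +-monoˡ-≤ c (*-monoˡ-≤ c 2h≤n) ⟩
  n * c + c                                         ≡⟨ cong (_+ c) (C-absorption n (h + i)) ⟨
  suc (h + i) * (n C suc (h + i)) + (h + i) * c + c
    ≡⟨ cong (λ j → suc (h + i) * (n C j) + (h + i) * c + c) (+-suc h i) ⟨
  suc (h + i) * c′ + (h + i) * c + c                ≡⟨ split h i c c′ ⟩
  suc h * c′ + (i * c′ + suc i * c) + h * c         ≤⟨ +-monoˡ-≤ (h * c) (+-monoʳ-≤ (suc h * c′)
                                                        (+-mono-≤ (*-monoʳ-≤ i (nCk≤middle n (h + suc i)))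
                                                                  (*-monoʳ-≤ (suc i) (nCk≤middle n (h + i))))) ⟩
  suc h * c′ + (i * M + suc i * M) + h * c
    ≡⟨ cong (λ x → suc h * c′ + x + h * c) (*-distribʳ-+ M i (suc i)) ⟨
  suc h * c′ + (i + suc i) * M + h * c              ∎)
  where
  open ≤-Reasoning
  h  = ⌊ n /2⌋
  M  = middle n
  c  = n C (h + i)
  c′ = n C (h + suc i)
  2h≤n : h + h ≤ n
  2h≤n = ≤-trans (+-monoʳ-≤ h (⌊n/2⌋≤⌈n/2⌉ n)) (≤-reflexive (⌊n/2⌋+⌈n/2⌉≡n n))
  double : ∀ h c → suc h * c + h * c ≡ (h + h) * c + c
  double = solve-∀
  split : ∀ h i c c′ → suc (h + i) * c′ + (h + i) * c + c ≡ suc h * c′ + (i * c′ + suc i * c) + h * c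
  split = solve-∀

-- The losses of the single steps are the odd numbers 1, 3, ..., 2i-1 times M, and these add up to
-- i² M. Hence C(n,h+i) ≥ (1 - i²/(h+1)) M.
C-near-middle : ∀ n i → let h = ⌊ n /2⌋ in
  suc h * middle n ≤ suc h * (n C (h + i)) + i * i * middle n
C-near-middle n zero    = ≤-reflexive
  (trans (cong (λ j → suc h * (n C j)) (sym (+-identityʳ h))) (sym (+-identityʳ _)))
  where h = ⌊ n /2⌋
C-near-middle n (suc i) = begin
  suc h * M                                              ≤⟨ C-near-middle n i ⟩
  suc h * (n C (h + i)) + i * i * M                      ≤⟨ +-monoˡ-≤ (i * i * M) (C-step-loss n i) ⟩
  suc h * (n C (h + suc i)) + (i + suc i) * M + i * i * M ≡⟨ square (suc h * (n C (h + suc i))) i M ⟩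
  suc h * (n C (h + suc i)) + suc i * suc i * M          ∎
  where
  open ≤-Reasoning
  h = ⌊ n /2⌋
  M = middle n
  square : ∀ x i M → x + (i + suc i) * M + i * i * M ≡ x + suc i * suc i * M
  square = solve-∀

levelsSize : ℕ → ℕ → ℕ → ℕ
levelsSize n s zero    = 0
levelsSize n s (suc k) = n C s + levelsSize n (suc s) k

-- The offset `i` is there for the induction; the intended instance is `i = 0`, `k = e`, with total
-- loss e³ M/(h+1).
levelsSize-near-middle : ∀ n e i k → i + k ≤ e → let h = ⌊ n /2⌋ in
  suc h * (k * middle n) ≤ suc h * levelsSize n (h + i) k + k * (e * e) * middle n
levelsSize-near-middle n e i zero    i+k≤e = ≤-trans (≤-reflexive (*-zeroʳ (suc ⌊ n /2⌋))) z≤n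
levelsSize-near-middle n e i (suc k) i+k≤e = begin
  suc h * (M + k * M)                              ≡⟨ *-distribˡ-+ (suc h) M (k * M) ⟩
  suc h * M + suc h * (k * M)                      ≤⟨ +-mono-≤ (C-near-middle n i)
                                                       (levelsSize-near-middle n e (suc i) k (subst (_≤ e) (+-suc i k) i+k≤e)) ⟩
  suc h * c + i * i * M + (suc h * levelsSize n (h + suc i) k + k * (e * e) * M)
    -- The loss i² of this level is coarsened to e², so that every level contributes the same
    -- amount.
    ≤⟨ +-monoˡ-≤ _ (+-monoʳ-≤ (suc h * c) (*-monoˡ-≤ M (*-mono-≤ i≤e i≤e))) ⟩
  suc h * c + e * e * M + (suc h * levelsSize n (h + suc i) k + k * (e * e) * M)
    ≡⟨ cong (λ j → suc h * c + e * e * M + (suc h * levelsSize n j k + k * (e * e) * M)) (+-suc h i) ⟩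
  suc h * c + e * e * M + (suc h * d + k * (e * e) * M)
    ≡⟨ regroup h c d (e * e) k M ⟩
  suc h * (c + d) + suc k * (e * e) * M            ∎
  where
  open ≤-Reasoning
  h = ⌊ n /2⌋
  M = middle n
  c = n C (h + i)
  d = levelsSize n (suc (h + i)) k
  i≤e : i ≤ e
  i≤e = ≤-trans (m≤m+n i (suc k)) i+k≤e
  regroup : ∀ h c d q k M → suc h * c + q * M + (suc h * d + k * q * M) ≡
    suc h * (c + d) + suc k * q * M
  regroup = solve-∀

-- Decay of the levels beyond 2n/3.

C-halving : ∀ n k → 2 * n ≤ 3 * k → 2 * (n C suc k) ≤ n C k
C-halving n k 2n≤3k = C-decreasing n 2 k (begin
  2 * n          ≤⟨ 2n≤3k ⟩
  3 * k          ≡⟨ +-comm k (2 * k) ⟩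
  2 * k + k      ≤⟨ +-monoʳ-≤ (2 * k) (n≤1+n k) ⟩
  2 * k + suc k  ∎)
  where open ≤-Reasoning

-- Repeated halving bounds the sum by the geometric series C(n,s) (1 + 1/2 + 1/4 + ...).
levelsSize-geometric : ∀ n s k → 2 * n ≤ 3 * s → levelsSize n s k ≤ 2 * (n C s)
levelsSize-geometric n s zero    2n≤3s = z≤n
levelsSize-geometric n s (suc k) 2n≤3s = begin
  n C s + levelsSize n (suc s) k
    ≤⟨ +-monoʳ-≤ (n C s) (levelsSize-geometric n (suc s) k (≤-trans 2n≤3s (*-monoʳ-≤ 3 (n≤1+n s)))) ⟩
  n C s + 2 * (n C suc s)         ≤⟨ +-monoʳ-≤ (n C s) (C-halving n s 2n≤3s) ⟩
  n C s + n C s                   ≡⟨ cong (λ x → n C s + x) (+-identityʳ (n C s)) ⟨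
  2 * (n C s)                     ∎
  where open ≤-Reasoning

-- Halving would even give a factor 2^j. The linear factor suffices for an O(M/n) tail, and it
-- survives each step because j+2 ≤ 2(j+1).
C-decay : ∀ n s j → 2 * n ≤ 3 * s → suc j * (n C (s + j)) ≤ n C s
C-decay n s zero    2n≤3s = ≤-reflexive (trans (*-identityˡ _) (cong (n C_) (+-identityʳ s)))
C-decay n s (suc j) 2n≤3s = begin
  suc (suc j) * (n C (s + suc j))      ≤⟨ *-monoˡ-≤ (n C (s + suc j)) (s≤s (m≤n+m (suc j) j)) ⟩
  suc (j + suc j) * (n C (s + suc j))  ≡⟨ cong₂ (λ x y → suc x * (n C y)) (+-suc j j) (+-suc s j) ⟩
  suc (suc (j + j)) * c                ≡⟨ double j c ⟩
  suc j * (2 * c)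
    ≤⟨ *-monoʳ-≤ (suc j) (C-halving n (s + j) (≤-trans 2n≤3s (*-monoʳ-≤ 3 (m≤m+n s j)))) ⟩
  suc j * (n C (s + j))                ≤⟨ C-decay n s j 2n≤3s ⟩
  n C s                                ∎
  where
  open ≤-Reasoning
  c = n C suc (s + j)
  double : ∀ j c → suc (suc (j + j)) * c ≡ suc j * (2 * c)
  double = solve-∀

-- Geometric summation makes all levels from `s + j` upwards cost at most twice the first of them,
-- and the `j` steps from `s` to `s + j` supply the factor 1/(j+1).
levelsSize-tail : ∀ n s k j → 2 * n ≤ 3 * s → suc j * levelsSize n (s + j) k ≤ 2 * middle n
levelsSize-tail n s k j 2n≤3s = begin
  suc j * levelsSize n (s + j) k
    ≤⟨ *-monoʳ-≤ (suc j) (levelsSize-geometric n (s + j) k (≤-trans 2n≤3s (*-monoʳ-≤ 3 (m≤m+n s j)))) ⟩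
  suc j * (2 * (n C (s + j)))      ≡⟨ swap (suc j) (n C (s + j)) ⟩
  2 * (suc j * (n C (s + j)))      ≤⟨ *-monoʳ-≤ 2 (C-decay n s j 2n≤3s) ⟩
  2 * (n C s)                      ≤⟨ *-monoʳ-≤ 2 (nCk≤middle n s) ⟩
  2 * middle n                     ∎
  where
  open ≤-Reasoning
  swap : ∀ a b → a * (2 * b) ≡ 2 * (a * b)
  swap = solve-∀

-- Repetition-free lists of the sets of prescribed sizes.

-- The recursion follows Pascal's rule, separating the sets that contain the first point from those
-- that avoid it, so the lengths are binomial coefficients.
level : ∀ n → ℕ → List (Subset n)
level zero    zero    = [ [] ]
level zero    (suc k) = []
level (suc n) zero    = map (outside ∷_) (level n zero)
level (suc n) (suc k) = map (inside ∷_) (level n k) ++ map (outside ∷_) (level n (suc k))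

length-level : ∀ n k → length (level n k) ≡ n C k
length-level zero    zero    = refl
length-level zero    (suc k) = sym (k>n⇒nCk≡0 {0} {suc k} z<s)
length-level (suc n) zero    = trans (length-map _ (level n zero)) (length-level n zero)
length-level (suc n) (suc k) = begin
  length (map (inside ∷_) (level n k) ++ map (outside ∷_) (level n (suc k)))
    ≡⟨ length-++ (map (inside ∷_) (level n k)) ⟩
  length (map (inside ∷_) (level n k)) + length (map (outside ∷_) (level n (suc k)))
    ≡⟨ cong₂ _+_ (trans (length-map _ (level n k)) (length-level n k))
                 (trans (length-map _ (level n (suc k))) (length-level n (suc k))) ⟩
  n C k + n C suc k
    ≡⟨ nCk+nC[k+1]≡[n+1]C[k+1] n k ⟩
  suc n C suc k ∎
  where open ≡-Reasoning

∈-level : ∀ {n} (A : Subset n) → A ∈ level n ∣ A ∣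
∈-level []            = here refl
∈-level (inside  ∷ A) = ∈-++⁺ˡ (∈-map⁺ (inside ∷_) (∈-level A))
-- Here the size is that of the tail, and `level` unfolds only once this number is known to be zero
-- or a successor.
∈-level (outside ∷ A) with ∣ A ∣ | ∈-level A
... | zero  | A∈ = ∈-map⁺ (outside ∷_) A∈
... | suc k | A∈ = ∈-++⁺ʳ _ (∈-map⁺ (outside ∷_) A∈)

level-card : ∀ n k → All (λ A → ∣ A ∣ ≡ k) (level n k)
level-card zero    zero    = refl ∷ []
level-card zero    (suc k) = []
level-card (suc n) zero    = Allₚ.map⁺ (level-card n zero)
level-card (suc n) (suc k) = Allₚ.++⁺ (Allₚ.map⁺ (All.map (cong suc) (level-card n k)))
                                      (Allₚ.map⁺ (level-card n (suc k)))

level-unique : ∀ n k → Unique (level n k)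
level-unique zero    zero    = [] ∷ []
level-unique zero    (suc k) = []
level-unique (suc n) zero    = Uniqueₚ.map⁺ ∷-injectiveʳ (level-unique n zero)
level-unique (suc n) (suc k) =
  Uniqueₚ.++⁺ (Uniqueₚ.map⁺ ∷-injectiveʳ (level-unique n k))
              (Uniqueₚ.map⁺ ∷-injectiveʳ (level-unique n (suc k)))
              disjoint
  where
  disjoint : ∀ {A} → A ∈ map (inside ∷_) (level n k) × A ∈ map (outside ∷_) (level n (suc k)) → _
  disjoint (p , q) with ∈-map⁻ (inside ∷_) p | ∈-map⁻ (outside ∷_) q
  ... | _ , _ , refl | _ , _ , ()

levels : ∀ n → ℕ → ℕ → List (Subset n)
levels n s zero    = []
levels n s (suc k) = level n s ++ levels n (suc s) k

length-levels : ∀ n s k → length (levels n s k) ≡ levelsSize n s k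
length-levels n s zero    = refl
length-levels n s (suc k) = trans (length-++ (level n s))
  (cong₂ _+_ (length-level n s) (length-levels n (suc s) k))

∈-levels : ∀ {n s} k (A : Subset n) → s ≤ ∣ A ∣ → ∣ A ∣ < s + k → A ∈ levels n s k
∈-levels {s = s} zero    A s≤ <s+k = contradiction (subst (∣ A ∣ <_) (+-identityʳ s) <s+k) (≤⇒≯ s≤)
∈-levels {s = s} (suc k) A s≤ <s+k with m≤n⇒m<n∨m≡n s≤
... | inj₁ s<   = ∈-++⁺ʳ (level _ s) (∈-levels k A s< (subst (∣ A ∣ <_) (+-suc s k) <s+k))
... | inj₂ refl = ∈-++⁺ˡ (∈-level A)

levels-card : ∀ n s k → All (λ A → s ≤ ∣ A ∣ × ∣ A ∣ < s + k) (levels n s k)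
levels-card n s zero    = []
levels-card n s (suc k) = Allₚ.++⁺
  (All.map (λ { refl → ≤-refl , m<m+n s z<s }) (level-card n s))
  (All.map (λ {A} (s< , <s+k) → <⇒≤ s< , subst (∣ A ∣ <_) (sym (+-suc s k)) <s+k)
           (levels-card n (suc s) k))

levels-unique : ∀ n s k → Unique (levels n s k)
levels-unique n s zero    = []
levels-unique n s (suc k) = Uniqueₚ.++⁺ (level-unique n s) (levels-unique n (suc s) k) disjoint
  where
  disjoint : ∀ {A} → A ∈ level n s × A ∈ levels n (suc s) k → _
  disjoint (p , q) = <-irrefl (sym (All.lookup (level-card n s) p))
    (proj₁ (All.lookup (levels-card n (suc s) k) q))

-- Counting the sets of extreme size.

-- One occurrence of the head `x` is cut out of `ys`. The remaining entries of `xs` differ from `x`,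
-- so they still occur in what is left, and induction applies.
unique-⊆⇒length≤ : ∀ {A : Set} {xs ys : List A} → Unique xs → xs ⊆ ys → length xs ≤ length ys
unique-⊆⇒length≤ []       xs⊆ys = z≤n
unique-⊆⇒length≤ {xs = x ∷ xs} (x∉xs ∷ u) xs⊆ys with ∈-∃++ (xs⊆ys (here refl))
... | ys₁ , ys₂ , refl = begin
  suc (length xs)
    ≤⟨ s≤s (unique-⊆⇒length≤ u (λ y∈xs → delete (All.lookup x∉xs y∈xs) (xs⊆ys (there y∈xs)))) ⟩
  suc (length (ys₁ ++ ys₂))    ≡⟨ cong suc (length-++ ys₁) ⟩
  suc (length ys₁ + length ys₂) ≡⟨ +-suc (length ys₁) (length ys₂) ⟨
  length ys₁ + suc (length ys₂) ≡⟨ length-++ ys₁ ⟨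
  length (ys₁ ++ x ∷ ys₂)      ∎
  where
  open ≤-Reasoning
  delete : ∀ {y} → x ≢ y → y ∈ ys₁ ++ x ∷ ys₂ → y ∈ ys₁ ++ ys₂
  delete x≢y y∈ with ∈-++⁻ ys₁ y∈
  ... | inj₁ y∈ys₁          = ∈-++⁺ˡ y∈ys₁
  ... | inj₂ (here refl)    = contradiction refl x≢y
  ... | inj₂ (there y∈ys₂)  = ∈-++⁺ʳ ys₁ y∈ys₂

-- Since 3/4 - 2/3 = 1/12, a set of size at least 3n/4 lies at least ⌊n/12⌋ levels above ⌈2n/3⌉,
-- where halving begins; `levelsSize-tail` then bounds the number of such sets.
tail-bound : ∀ {n} {xs : List (Subset n)} → Unique xs → All (λ A → 3 * n ≤ 4 * ∣ A ∣) xs →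
             suc (n / 12) * length xs ≤ 2 * middle n
tail-bound {n} {xs} u large = begin
  suc j * length xs                          ≤⟨ *-monoʳ-≤ (suc j) (unique-⊆⇒length≤ u
                                                 -- Taking `suc n` levels is enough to pass size n,
                                                 -- wherever the range starts.
                                                 (λ {A} A∈ → ∈-levels (suc n) A (s+j≤ A (All.lookup large A∈)) (<s+j+1+n A))) ⟩
  suc j * length (levels n (s + j) (suc n))  ≡⟨ cong (suc j *_) (length-levels n (s + j) (suc n)) ⟩
  suc j * levelsSize n (s + j) (suc n)       ≤⟨ levelsSize-tail n s (suc n) j 2n≤3s ⟩
  2 * middle n                               ∎
  where
  open ≤-Reasoning
  j = n / 12
  -- This is ⌈2n/3⌉, the least `s` with 2n ≤ 3s.
  s = (2 * n + 2) / 3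
  2n≤3s : 2 * n ≤ 3 * s
  2n≤3s = +-cancelʳ-≤ 2 _ _ (begin
    2 * n + 2                    ≡⟨ m≡m%n+[m/n]*n (2 * n + 2) 3 ⟩
    (2 * n + 2) % 3 + s * 3      ≤⟨ +-monoˡ-≤ (s * 3) (s≤s⁻¹ (m%n<n (2 * n + 2) 3)) ⟩
    2 + s * 3                    ≡⟨ +-comm 2 (s * 3) ⟩
    s * 3 + 2                    ≡⟨ cong (_+ 2) (*-comm s 3) ⟩
    3 * s + 2                    ∎)
  s+j≤ : ∀ (A : Subset n) → 3 * n ≤ 4 * ∣ A ∣ → s + j ≤ ∣ A ∣
  -- After multiplication by 12 the rounding in `s` costs at most 8. As 8 < 12, this gives s + j <
  -- |A| + 1, and integrality removes the error.
  s+j≤ A 3n≤4a = s≤s⁻¹ (*-cancelˡ-< 12 _ _ (begin-strict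
    12 * (s + j)                 ≡⟨ split s j ⟩
    4 * (s * 3) + j * 12         ≤⟨ +-mono-≤ (*-monoʳ-≤ 4 (m/n*n≤m (2 * n + 2) 3)) (m/n*n≤m n 12) ⟩
    4 * (2 * n + 2) + n          ≡⟨ collect n ⟩
    3 * (3 * n) + 8              ≤⟨ +-monoˡ-≤ 8 (*-monoʳ-≤ 3 3n≤4a) ⟩
    3 * (4 * ∣ A ∣) + 8          <⟨ +-monoʳ-< (3 * (4 * ∣ A ∣)) (toWitness {a? = 8 <? 12} _) ⟩
    3 * (4 * ∣ A ∣) + 12         ≡⟨ final ∣ A ∣ ⟩
    12 * suc ∣ A ∣               ∎))
    where
    split : ∀ s j → 12 * (s + j) ≡ 4 * (s * 3) + j * 12
    split = solve-∀
    collect : ∀ n → 4 * (2 * n + 2) + n ≡ 3 * (3 * n) + 8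
    collect = solve-∀
    final : ∀ a → 3 * (4 * a) + 12 ≡ 12 * suc a
    final = solve-∀
  <s+j+1+n : ∀ (A : Subset n) → ∣ A ∣ < s + j + suc n
  <s+j+1+n A = <-≤-trans (s≤s (∣p∣≤n A)) (m≤n+m (suc n) (s + j))

∁-injective : ∀ {n} {A B : Subset n} → ∁ A ≡ ∁ B → A ≡ B
∁-injective {A = []}    {[]}    _  = refl
∁-injective {A = _ ∷ _} {_ ∷ _} eq =
  cong₂ _∷_ (not-injective (∷-injectiveˡ eq)) (∁-injective (∷-injectiveʳ eq))

-- Complementation is injective and carries sizes at most n/4 to sizes at least 3n/4.
tail-bound-∁ : ∀ {n} {xs : List (Subset n)} → Unique xs → All (λ A → 4 * ∣ A ∣ ≤ n) xs →
               suc (n / 12) * length xs ≤ 2 * middle n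
tail-bound-∁ {n} {xs} u small = subst (λ l → suc (n / 12) * l ≤ 2 * middle n) (length-map ∁ xs)
  (tail-bound (Uniqueₚ.map⁺ ∁-injective u) (Allₚ.map⁺ (All.map (λ {A} → large A) small)))
  where
  open ≤-Reasoning
  large : ∀ (A : Subset n) → 4 * ∣ A ∣ ≤ n → 3 * n ≤ 4 * ∣ ∁ A ∣
  large A 4a≤n = begin
    3 * n                  ≡⟨ m+n∸m≡n n (3 * n) ⟨
    4 * n ∸ n              ≤⟨ ∸-monoʳ-≤ (4 * n) 4a≤n ⟩
    4 * n ∸ 4 * ∣ A ∣      ≡⟨ *-distribˡ-∸ 4 n ∣ A ∣ ⟨
    4 * (n ∸ ∣ A ∣)        ≡⟨ cong (4 *_) (∣∁p∣≡n∸∣p∣ A) ⟨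
    4 * ∣ ∁ A ∣            ∎

-- Transfer of natural-number estimates to the rationals.

-- A normalised fraction involves a gcd, which blocks computation with variables. Identities and
-- inequalities are therefore checked on unnormalised fractions and carried over by `fromℚᵘ`, of
-- which `fromℕ` is an instance with denominator 1.
fromℚᵘ-homo-* : ∀ p q → ℚ.fromℚᵘ (p ℚᵘ.* q) ≡ ℚ.fromℚᵘ p ℚ.* ℚ.fromℚᵘ q
fromℚᵘ-homo-* p q = ℚₚ.toℚᵘ-injective (begin
  ℚ.toℚᵘ (ℚ.fromℚᵘ (p ℚᵘ.* q))                       ≈⟨ ℚₚ.toℚᵘ-fromℚᵘ (p ℚᵘ.* q) ⟩
  p ℚᵘ.* q
    ≈⟨ ℚᵘₚ.*-cong (ℚₚ.toℚᵘ-fromℚᵘ p) (ℚₚ.toℚᵘ-fromℚᵘ q) ⟨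
  ℚ.toℚᵘ (ℚ.fromℚᵘ p) ℚᵘ.* ℚ.toℚᵘ (ℚ.fromℚᵘ q)       ≈⟨ ℚₚ.toℚᵘ-homo-* (ℚ.fromℚᵘ p) (ℚ.fromℚᵘ q) ⟨
  ℚ.toℚᵘ (ℚ.fromℚᵘ p ℚ.* ℚ.fromℚᵘ q)                 ∎)
  where open ℚᵘₚ.≃-Reasoning

fromℚᵘ-homo-+ : ∀ p q → ℚ.fromℚᵘ (p ℚᵘ.+ q) ≡ ℚ.fromℚᵘ p ℚ.+ ℚ.fromℚᵘ q
fromℚᵘ-homo-+ p q = ℚₚ.toℚᵘ-injective (begin
  ℚ.toℚᵘ (ℚ.fromℚᵘ (p ℚᵘ.+ q))                       ≈⟨ ℚₚ.toℚᵘ-fromℚᵘ (p ℚᵘ.+ q) ⟩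
  p ℚᵘ.+ q
    ≈⟨ ℚᵘₚ.+-cong (ℚₚ.toℚᵘ-fromℚᵘ p) (ℚₚ.toℚᵘ-fromℚᵘ q) ⟨
  ℚ.toℚᵘ (ℚ.fromℚᵘ p) ℚᵘ.+ ℚ.toℚᵘ (ℚ.fromℚᵘ q)       ≈⟨ ℚₚ.toℚᵘ-homo-+ (ℚ.fromℚᵘ p) (ℚ.fromℚᵘ q) ⟨
  ℚ.toℚᵘ (ℚ.fromℚᵘ p ℚ.+ ℚ.fromℚᵘ q)                 ∎)
  where open ℚᵘₚ.≃-Reasoning

fromℚᵘ-mono-≤ : ∀ {p q} → p ℚᵘ.≤ q → ℚ.fromℚᵘ p ℚ.≤ ℚ.fromℚᵘ q
fromℚᵘ-mono-≤ {p} {q} p≤q = ℚₚ.toℚᵘ-cancel-≤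
  (ℚᵘₚ.≤-respˡ-≃ (ℚᵘₚ.≃-sym (ℚₚ.toℚᵘ-fromℚᵘ p)) (ℚᵘₚ.≤-respʳ-≃ (ℚᵘₚ.≃-sym (ℚₚ.toℚᵘ-fromℚᵘ q)) p≤q))

fromℚᵘ-mono-< : ∀ {p q} → p ℚᵘ.< q → ℚ.fromℚᵘ p ℚ.< ℚ.fromℚᵘ q
fromℚᵘ-mono-< {p} {q} p<q = ℚₚ.toℚᵘ-cancel-<
  (ℚᵘₚ.<-respˡ-≃ (ℚᵘₚ.≃-sym (ℚₚ.toℚᵘ-fromℚᵘ p)) (ℚᵘₚ.<-respʳ-≃ (ℚᵘₚ.≃-sym (ℚₚ.toℚᵘ-fromℚᵘ q)) p<q))

fromℕ-homo-* : ∀ a b → fromℕ (a * b) ≡ fromℕ a ℚ.* fromℕ b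
fromℕ-homo-* a b = trans (cong (λ i → ℚ.fromℚᵘ (mkℚᵘ i 0)) (ℤₚ.pos-* a b))
  (fromℚᵘ-homo-* (mkℚᵘ (+ a) 0) (mkℚᵘ (+ b) 0))

fromℕ-homo-+ : ∀ a b → fromℕ (a + b) ≡ fromℕ a ℚ.+ fromℕ b
fromℕ-homo-+ a b = trans
  (cong (λ i → ℚ.fromℚᵘ (mkℚᵘ i 0)) (sym (cong₂ ℤ._+_ (ℤₚ.*-identityʳ (+ a)) (ℤₚ.*-identityʳ (+ b)))))
  (fromℚᵘ-homo-+ (mkℚᵘ (+ a) 0) (mkℚᵘ (+ b) 0))

fromℕ-mono-≤ : ∀ {a b} → a ≤ b → fromℕ a ℚ.≤ fromℕ b
fromℕ-mono-≤ {a} {b} a≤b = fromℚᵘ-mono-≤ {mkℚᵘ (+ a) 0} {mkℚᵘ (+ b) 0}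
  (ℚᵘ.*≤* (ℤₚ.*-monoʳ-≤-nonNeg (+ 1) (ℤ.+≤+ a≤b)))

fromℕ-mono-< : ∀ {a b} → a < b → fromℕ a ℚ.< fromℕ b
fromℕ-mono-< {a} {b} a<b = fromℚᵘ-mono-< {mkℚᵘ (+ a) 0} {mkℚᵘ (+ b) 0}
  (ℚᵘ.*<* (ℤₚ.*-monoʳ-<-pos (+ 1) (ℤ.+<+ a<b)))

fromℕ-cancel-≤ : ∀ {a b} → fromℕ a ℚ.≤ fromℕ b → a ≤ b
fromℕ-cancel-≤ p = ≮⇒≥ λ b<a → ℚₚ.<-irrefl refl (ℚₚ.<-≤-trans (fromℕ-mono-< b<a) p)

fromℕ-nonNeg : ∀ a → ℚ.NonNegative (fromℕ a)
fromℕ-nonNeg a = ℚ.nonNegative (fromℕ-mono-≤ {0} {a} z≤n)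

/-*-cancel : ∀ a b .{{_ : NonZero b}} → (+ a ℚ./ b) ℚ.* fromℕ b ≡ fromℕ a
/-*-cancel a (suc b) = trans (sym (fromℚᵘ-homo-* (mkℚᵘ (+ a) b) (mkℚᵘ (+ suc b) 0)))
  (ℚₚ.fromℚᵘ-cong {mkℚᵘ (+ a) b ℚᵘ.* mkℚᵘ (+ suc b) 0} {mkℚᵘ (+ a) 0}
    (ℚᵘ.*≡* (trans (ℤₚ.*-identityʳ _) (cong (λ m → + a ℤ.* + m) (sym (*-identityʳ (suc b)))))))

-- A positive fraction has numerator at least 1, so it is at least the reciprocal of its
-- denominator. This turns every rational ε into an explicit natural threshold.
1≤p*↧p : ∀ p → 0ℚ ℚ.< p → 1ℚ ℚ.≤ p ℚ.* fromℕ (↧ₙ p)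
1≤p*↧p p@(mkℚ (+ suc m) d _) 0<p = subst (1ℚ ℚ.≤_)
  (trans (sym (/-*-cancel (suc m) (suc d))) (cong (ℚ._* fromℕ (suc d)) (ℚₚ.↥p/↧p≡p p)))
  (fromℕ-mono-≤ {1} {suc m} (s≤s z≤n))
1≤p*↧p (mkℚ (+ 0) d _)     (ℚ.*<* (ℤ.+<+ ()))
1≤p*↧p (mkℚ ℤ.-[1+ m ] d _) (ℚ.*<* ())

-- With d the denominator of ε, the chain is b/M ≤ c/t < 1/d ≤ ε, with denominators cleared. Both
-- error terms of the proof are absorbed this way: the deficit of the middle levels with `t` equal
-- to ⌊n/2⌋ + 1, and the tail with `t` equal to ⌊n/12⌋ + 1.
small-fraction : ∀ {ε} c t b M → 0ℚ ℚ.< ε → 0 < M → t * b ≤ c * M → c * ↧ₙ ε < t →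
                 fromℕ b ℚ.< ε ℚ.* fromℕ M
small-fraction {ε} c t b M 0<ε 0<M tb≤cM cd<t =
  ℚₚ.*-cancelˡ-<-nonNeg (fromℕ d) {{fromℕ-nonNeg d}} (begin-strict
  fromℕ d ℚ.* fromℕ b           ≡⟨ fromℕ-homo-* d b ⟨
  fromℕ (d * b)                 <⟨ fromℕ-mono-< (*-cancelˡ-< t (d * b) M td*b<tM) ⟩
  fromℕ M                       ≡⟨ ℚₚ.*-identityˡ (fromℕ M) ⟨
  1ℚ ℚ.* fromℕ M                ≤⟨ ℚₚ.*-monoʳ-≤-nonNeg (fromℕ M) {{fromℕ-nonNeg M}} (1≤p*↧p ε 0<ε) ⟩
  ε ℚ.* fromℕ d ℚ.* fromℕ M     ≡⟨ cong (ℚ._* fromℕ M) (ℚₚ.*-comm ε (fromℕ d)) ⟩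
  fromℕ d ℚ.* ε ℚ.* fromℕ M     ≡⟨ ℚₚ.*-assoc (fromℕ d) ε (fromℕ M) ⟩
  fromℕ d ℚ.* (ε ℚ.* fromℕ M)   ∎)
  where
  d = ↧ₙ ε
  open ℚₚ.≤-Reasoning
  td*b<tM : t * (d * b) < t * M
  td*b<tM = N.begin-strict
    t * (d * b)   N.≡⟨ swap t d b ⟩
    d * (t * b)   N.≤⟨ *-monoʳ-≤ d tb≤cM ⟩
    d * (c * M)   N.≡⟨ assoc d c M ⟩
    c * d * M     N.<⟨ *-monoˡ-< M {{>-nonZero 0<M}} cd<t ⟩
    t * M         N.∎
    where
    module N = ≤-Reasoning
    swap : ∀ t d b → t * (d * b) ≡ d * (t * b)
    swap = solve-∀
    assoc : ∀ d c M → d * (c * M) ≡ c * d * M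
    assoc = solve-∀

-- From the Lubell function to cardinality.

length≤foldr-weights* : ∀ {A : Set} (w : A → ℚ) M → (∀ a → 1ℚ ℚ.≤ w a ℚ.* fromℕ M) →
                      ∀ xs → fromℕ (length xs) ℚ.≤ foldr ℚ._+_ 0ℚ (map w xs) ℚ.* fromℕ M
length≤foldr-weights* w M 1≤ []       = ℚₚ.≤-reflexive (sym (ℚₚ.*-zeroˡ (fromℕ M)))
length≤foldr-weights* w M 1≤ (x ∷ xs) = begin
  fromℕ (1 + length xs)                        ≡⟨ fromℕ-homo-+ 1 (length xs) ⟩
  1ℚ ℚ.+ fromℕ (length xs)                     ≤⟨ ℚₚ.+-mono-≤ (1≤ x) (length≤foldr-weights* w M 1≤ xs) ⟩
  w x ℚ.* fromℕ M ℚ.+ Σw ℚ.* fromℕ M           ≡⟨ ℚₚ.*-distribʳ-+ (fromℕ M) (w x) Σw ⟨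
  (w x ℚ.+ Σw) ℚ.* fromℕ M                     ∎
  where
  open ℚₚ.≤-Reasoning
  Σw = foldr ℚ._+_ 0ℚ (map w xs)

-- Each weight 1/C(n,|A|) is at least 1/M because M is the largest coefficient.
#≤lubell*middle : ∀ {n} (𝓕 : Family n) → fromℕ (# 𝓕) ℚ.≤ lubell 𝓕 ℚ.* fromℕ (middle n)
#≤lubell*middle {n} 𝓕 = length≤foldr-weights* _ (middle n) 1≤weight (members 𝓕)
  where
  open ℚₚ.≤-Reasoning
  1≤weight : ∀ (A : Subset n) →
    1ℚ ℚ.≤ (+ 1 ℚ./ (n C ∣ A ∣)) {{nCk-nonZero (∣p∣≤n A)}} ℚ.* fromℕ (middle n)
  1≤weight A = begin
    1ℚ                               ≡⟨ /-*-cancel 1 (n C ∣ A ∣) ⟨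
    w ℚ.* fromℕ (n C ∣ A ∣)
      ≤⟨ ℚₚ.*-monoˡ-≤-nonNeg w {{w-nonNeg}} (fromℕ-mono-≤ (nCk≤middle n ∣ A ∣)) ⟩
    w ℚ.* fromℕ (middle n)           ∎
    where
    instance
      nz : NonZero (n C ∣ A ∣)
      nz = nCk-nonZero (∣p∣≤n A)
    w = + 1 ℚ./ (n C ∣ A ∣)
    w-nonNeg : ℚ.NonNegative w
    w-nonNeg = ℚₚ.normalize-nonNeg 1 (n C ∣ A ∣)

-- Bounds on free families at a fixed n.

length-filter+¬filter : ∀ {A : Set} {Q : Pred A 0ℓ} (Q? : Decidable Q) xs →
                   length xs ≡ length (filter Q? xs) + length (filter (¬? ∘ Q?) xs)
length-filter+¬filter Q? []       = refl
length-filter+¬filter Q? (x ∷ xs) with Q? x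
... | yes _ = cong suc (length-filter+¬filter Q? xs)
... | no  _ = trans (cong suc (length-filter+¬filter Q? xs)) (sym (+-suc _ _))

free-mono : ∀ P {n} {𝓕 𝓖 : Pred (Subset n) 0ℓ} → (∀ A → 𝓕 A → 𝓖 A) → (P -Free) 𝓖 → (P -Free) 𝓕
free-mono P 𝓕⊆𝓖 free (f , mem , inj , mono) = free (f , (λ u → 𝓕⊆𝓖 (f u) (mem u)) , inj , mono)

middle>0 : ∀ n → 0 < middle n
middle>0 n = >-nonZero⁻¹ (middle n) {{nCk-nonZero (⌊n/2⌋≤n n)}}

-- By the definition of e(P), the `e` levels starting at ⌊n/2⌋ form a P-free family, so `La P n` is
-- at least their total size.
La-lower : ∀ P {e} → e Is-e-Of P → ∀ n →
  suc ⌊ n /2⌋ * (e * middle n) ≤ suc ⌊ n /2⌋ * La P n + e * (e * e) * middle n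
La-lower P {e} (free , _) n = begin
  suc h * (e * middle n)                                      ≤⟨ levelsSize-near-middle n e 0 e ≤-refl ⟩
  suc h * levelsSize n (h + 0) e + e * (e * e) * middle n
    ≤⟨ +-monoˡ-≤ _ (*-monoʳ-≤ (suc h) size≤La) ⟩
  suc h * La P n + e * (e * e) * middle n                     ∎
  where
  open ≤-Reasoning
  h = ⌊ n /2⌋
  inLevels : ∀ A → A ∈ levels n (h + 0) e → Levels n (+ (h + 0)) e A
  inLevels A A∈ = let s≤ , <s+e = All.lookup (levels-card n (h + 0) e) A∈ in ℤ.+≤+ s≤ , ℤ.+<+ <s+e
  size≤La : levelsSize n (h + 0) e ≤ La P n
  size≤La = proj₂ (La-isMaximum P n) _
    ( family (levels n (h + 0) e) (levels-unique n (h + 0) e)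
    , free-mono P inLevels (free n (+ (h + 0)))
    , length-levels n (h + 0) e )

-- The predicate `Q` stands for either size restriction, so that both kinds of L-boundedness share
-- one argument. The members satisfying `Q` form a free family of at most c M sets; the others fall
-- under the tail bound and number less than δ M.
#free-upper : ∀ P n {Q : Pred (Subset n) 0ℓ} (Q? : Decidable Q) {c δ} → 0ℚ ℚ.< δ →
  (∀ (𝓖 : Family n) → (P -Free) ⟦ 𝓖 ⟧ → All Q (members 𝓖) → lubell 𝓖 ℚ.≤ c) →
  (∀ {xs} → Unique xs → All (λ A → ¬ Q A) xs → suc (n / 12) * length xs ≤ 2 * middle n) →
  2 * ↧ₙ δ ≤ n / 12 →
  ∀ (𝓕 : Family n) → (P -Free) ⟦ 𝓕 ⟧ → fromℕ (# 𝓕) ℚ.< (c ℚ.+ δ) ℚ.* fromℕ (middle n)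
#free-upper P n {Q} Q? {c} {δ} 0<δ bounded tail 2d≤ 𝓕@(family xs u) free = begin-strict
  fromℕ (# 𝓕)                             ≡⟨ cong fromℕ (length-filter+¬filter Q? xs) ⟩
  fromℕ (# 𝓖 + length ys)                 ≡⟨ fromℕ-homo-+ (# 𝓖) (length ys) ⟩
  fromℕ (# 𝓖) ℚ.+ fromℕ (length ys)       <⟨ ℚₚ.+-mono-≤-< #𝓖≤ ys< ⟩
  c ℚ.* fromℕ M ℚ.+ δ ℚ.* fromℕ M         ≡⟨ ℚₚ.*-distribʳ-+ (fromℕ M) c δ ⟨
  (c ℚ.+ δ) ℚ.* fromℕ M                   ∎
  where
  open ℚₚ.≤-Reasoning
  M = middle n
  𝓖 = family (filter Q? xs) (Uniqueₚ.filter⁺ Q? u)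
  ys = filter (¬? ∘ Q?) xs
  #𝓖≤ : fromℕ (# 𝓖) ℚ.≤ c ℚ.* fromℕ M
  #𝓖≤ = ℚₚ.≤-trans (#≤lubell*middle 𝓖) (ℚₚ.*-monoʳ-≤-nonNeg (fromℕ M) {{fromℕ-nonNeg M}}
    (bounded 𝓖 (free-mono P (λ A A∈ → proj₁ (∈-filter⁻ Q? {v = A} {xs = xs} A∈)) free)
               (Allₚ.all-filter Q? xs)))
  ys< : fromℕ (length ys) ℚ.< δ ℚ.* fromℕ M
  ys< = small-fraction 2 (suc (n / 12)) (length ys) M 0<δ (middle>0 n)
    (tail (Uniqueₚ.filter⁺ (¬? ∘ Q?) u) (Allₚ.all-filter (¬? ∘ Q?) xs)) (s≤s 2d≤)

-- Absolute values and the cut-offs 3n/4 and n/4.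

p<q+ε⇒p-q<ε : ∀ {p q ε} → p ℚ.< q ℚ.+ ε → p ℚ.- q ℚ.< ε
p<q+ε⇒p-q<ε {p} {q} {ε} p<q+ε = subst (p ℚ.- q ℚ.<_)
  (solve 2 (λ q ε → q :+ ε :- q := ε) refl q ε) (ℚₚ.+-monoˡ-< (ℚ.- q) p<q+ε)
  where open +-*-Solver

∣p-q∣<ε : ∀ {p q ε} → p ℚ.< q ℚ.+ ε → q ℚ.< p ℚ.+ ε → ℚ.∣ p ℚ.- q ∣ ℚ.< ε
∣p-q∣<ε {p} {q} {ε} p<q+ε q<p+ε with ℚₚ.∣p∣≡p∨∣p∣≡-p (p ℚ.- q)
... | inj₁ eq = subst (ℚ._< ε) (sym eq) (p<q+ε⇒p-q<ε p<q+ε)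
... | inj₂ eq = subst (ℚ._< ε) (trans (solve 2 (λ p q → q :- p := :- (p :- q)) refl p q) (sym eq))
                           (p<q+ε⇒p-q<ε q<p+ε)
  where open +-*-Solver

¾ : ℚ
¾ = + 3 ℚ./ 4

¼ : ℚ
¼ = + 1 ℚ./ 4

4*[k/4*n] : ∀ k n → fromℕ 4 ℚ.* ((+ k ℚ./ 4) ℚ.* fromℕ n) ≡ fromℕ (k * n)
4*[k/4*n] k n = begin
  fromℕ 4 ℚ.* ((+ k ℚ./ 4) ℚ.* fromℕ n)  ≡⟨ ℚₚ.*-assoc (fromℕ 4) (+ k ℚ./ 4) (fromℕ n) ⟨
  fromℕ 4 ℚ.* (+ k ℚ./ 4) ℚ.* fromℕ n
    ≡⟨ cong (ℚ._* fromℕ n) (trans (ℚₚ.*-comm (fromℕ 4) (+ k ℚ./ 4)) (/-*-cancel k 4)) ⟩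
  fromℕ k ℚ.* fromℕ n                    ≡⟨ fromℕ-homo-* k n ⟨
  fromℕ (k * n)                          ∎
  where open ≡-Reasoning

¾n≤a⇒3n≤4a : ∀ {n a} → ¾ ℚ.* fromℕ n ℚ.≤ fromℕ a → 3 * n ≤ 4 * a
¾n≤a⇒3n≤4a {n} {a} ¾n≤a = fromℕ-cancel-≤ (begin
  fromℕ (3 * n)                 ≡⟨ 4*[k/4*n] 3 n ⟨
  fromℕ 4 ℚ.* (¾ ℚ.* fromℕ n)   ≤⟨ ℚₚ.*-monoˡ-≤-nonNeg (fromℕ 4) ¾n≤a ⟩
  fromℕ 4 ℚ.* fromℕ a           ≡⟨ fromℕ-homo-* 4 a ⟨
  fromℕ (4 * a)                 ∎)
  where open ℚₚ.≤-Reasoning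

a≤¼n⇒4a≤n : ∀ {n a} → fromℕ a ℚ.≤ ¼ ℚ.* fromℕ n → 4 * a ≤ n
a≤¼n⇒4a≤n {n} {a} a≤¼n = fromℕ-cancel-≤ (begin
  fromℕ (4 * a)                 ≡⟨ fromℕ-homo-* 4 a ⟩
  fromℕ 4 ℚ.* fromℕ a           ≤⟨ ℚₚ.*-monoˡ-≤-nonNeg (fromℕ 4) a≤¼n ⟩
  fromℕ 4 ℚ.* (¼ ℚ.* fromℕ n)   ≡⟨ 4*[k/4*n] 1 n ⟩
  fromℕ (1 * n)                 ≡⟨ cong fromℕ (*-identityˡ n) ⟩
  fromℕ n                       ∎)
  where open ℚₚ.≤-Reasoning

-- Asymptotic bounds and the limit.

-- One δ comes from L-boundedness and the other from the discarded sets. The cut-off 3/4 lies above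
-- 2/3, and 1/4 is its mirror image, which leaves the margin n/12 used by the tail bounds.
free-eventually-≤ : ∀ P {e} → e Is-e-Of P → LowerLBounded P ⊎ UpperLBounded P → ∀ δ → 0ℚ ℚ.< δ →
  ∃[ N ] ∀ n → N ≤ n → 2 * ↧ₙ δ ≤ n / 12 → ∀ (𝓕 : Family n) → (P -Free) ⟦ 𝓕 ⟧ →
    fromℕ (# 𝓕) ℚ.< (fromℕ e ℚ.+ δ ℚ.+ δ) ℚ.* fromℕ (middle n)
free-eventually-≤ P isE (inj₁ lower) δ 0<δ =
  let N , bounded = lower isE ¾ δ ½<¾ ¾<1 0<δ in
  N , λ n N≤n 2d≤ → #free-upper P n
    {λ A → fromℕ ∣ A ∣ ℚ.< ¾ ℚ.* fromℕ n} (λ A → fromℕ ∣ A ∣ ℚₚ.<? ¾ ℚ.* fromℕ n)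
    0<δ (bounded n N≤n)
    (λ u large → tail-bound u (All.map (λ {A} → ¾n≤a⇒3n≤4a {n} {∣ A ∣} ∘ ℚₚ.≮⇒≥) large)) 2d≤
  where
  ½<¾ : ½ ℚ.< ¾
  ½<¾ = from-yes (½ ℚₚ.<? ¾)
  ¾<1 : ¾ ℚ.< 1ℚ
  ¾<1 = from-yes (¾ ℚₚ.<? 1ℚ)
free-eventually-≤ P isE (inj₂ upper) δ 0<δ =
  let N , bounded = upper isE ¼ δ 0<¼ ¼<½ 0<δ in
  N , λ n N≤n 2d≤ → #free-upper P n
    {λ A → ¼ ℚ.* fromℕ n ℚ.< fromℕ ∣ A ∣} (λ A → ¼ ℚ.* fromℕ n ℚₚ.<? fromℕ ∣ A ∣)
    0<δ (bounded n N≤n)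
    (λ u small → tail-bound-∁ u (All.map (λ {A} → a≤¼n⇒4a≤n {n} {∣ A ∣} ∘ ℚₚ.≮⇒≥) small)) 2d≤
  where
  0<¼ : 0ℚ ℚ.< ¼
  0<¼ = from-yes (0ℚ ℚₚ.<? ¼)
  ¼<½ : ¼ ℚ.< ½
  ¼<½ = from-yes (¼ ℚₚ.<? ½)

La-eventually-≤ : ∀ P {e} → e Is-e-Of P → LowerLBounded P ⊎ UpperLBounded P → ∀ δ → 0ℚ ℚ.< δ →
  ∃[ N ] ∀ n → N ≤ n → 2 * ↧ₙ δ ≤ n / 12 →
    fromℕ (La P n) ℚ.< (fromℕ e ℚ.+ δ ℚ.+ δ) ℚ.* fromℕ (middle n)
La-eventually-≤ P {e} isE bounded δ 0<δ = let N , #< = free-eventually-≤ P isE bounded δ 0<δ in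
  N , λ n N≤n 2d≤ → let (𝓕 , free , #𝓕≡La) , _ = La-isMaximum P n in
    subst (λ m → fromℕ m ℚ.< (fromℕ e ℚ.+ δ ℚ.+ δ) ℚ.* fromℕ (middle n)) #𝓕≡La (#< n N≤n 2d≤ 𝓕 free)

-- The deficit e³ M/(h+1) allowed by `La-lower` falls below ε M once h = ⌊n/2⌋ reaches e³ times the
-- denominator of ε.
La-eventually-≥ : ∀ P {e} → e Is-e-Of P → ∀ ε → 0ℚ ℚ.< ε → ∀ n → e * (e * e) * ↧ₙ ε ≤ ⌊ n /2⌋ →
  fromℕ e ℚ.* fromℕ (middle n) ℚ.< fromℕ (La P n) ℚ.+ ε ℚ.* fromℕ (middle n)
La-eventually-≥ P {e} isE ε 0<ε n large = begin-strict
  fromℕ e ℚ.* fromℕ M                   ≡⟨ fromℕ-homo-* e M ⟨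
  fromℕ (e * M)                         ≤⟨ fromℕ-mono-≤ (m≤n+m∸n (e * M) (La P n)) ⟩
  fromℕ (La P n + b)                    ≡⟨ fromℕ-homo-+ (La P n) b ⟩
  fromℕ (La P n) ℚ.+ fromℕ b            <⟨ ℚₚ.+-monoʳ-< (fromℕ (La P n))
                                             (small-fraction (e * (e * e)) (suc h) b M 0<ε (middle>0 n) deficit (s≤s large)) ⟩
  fromℕ (La P n) ℚ.+ ε ℚ.* fromℕ M      ∎
  where
  open ℚₚ.≤-Reasoning
  M = middle n
  h = ⌊ n /2⌋
  -- The subtraction is truncated: if `La P n` already exceeds e M, the deficit is 0 and both
  -- estimates remain valid.
  b = e * M ∸ La P n
  deficit : suc h * b ≤ e * (e * e) * M
  deficit = subst (_≤ e * (e * e) * M) (sym (*-distribˡ-∸ (suc h) (e * M) (La P n)))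
    (m≤n+o⇒m∸n≤o (suc h * (e * M)) (suc h * La P n) (La-lower P isE n))

proposition3p5 : ∀ (P : FinPoset) {e} → e Is-e-Of P →
    LowerLBounded P ⊎ UpperLBounded P →
    La-ratio P ⟶ fromℕ e
-- The two one-sided inequalities are proved after multiplication by M, which turns the ratio into
-- `La P n`.
proposition3p5 P {e} isE bounded ε 0<ε = N , λ n N≤n → ∣p-q∣<ε {La-ratio P n} {fromℕ e}
  (ℚₚ.*-cancelʳ-<-nonNeg (fromℕ (middle n)) {{fromℕ-nonNeg (middle n)}}
    {La-ratio P n} {fromℕ e ℚ.+ ε}
    (ratio< n N≤n))
  (ℚₚ.*-cancelʳ-<-nonNeg (fromℕ (middle n)) {{fromℕ-nonNeg (middle n)}}
    {fromℕ e} {La-ratio P n ℚ.+ ε}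
    (ratio> n N≤n))
  where
  open ℚₚ.≤-Reasoning
  -- The upper bound loses δ twice.
  δ = ½ ℚ.* ε
  0<δ : 0ℚ ℚ.< δ
  0<δ = ℚₚ.*-monoʳ-<-pos ½ 0<ε
  δ+δ≡ε : δ ℚ.+ δ ≡ ε
  δ+δ≡ε = trans (sym (ℚₚ.*-distribʳ-+ ε ½ ½)) (ℚₚ.*-identityˡ ε)
  eventually = La-eventually-≤ P isE bounded δ 0<δ
  N₁ = proj₁ eventually
  -- From n ≥ `N₂` follows n / 12 ≥ 2 d, with d the denominator of δ, as the tail estimate demands.
  N₂ = 2 * ↧ₙ δ * 12
  N₃ = e * (e * e) * ↧ₙ ε
  -- `N₃` enters twice because the lower bound needs ⌊n/2⌋ ≥ `N₃`.
  N  = N₁ + N₂ + (N₃ + N₃)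
  ratio*middle : ∀ n → La-ratio P n ℚ.* fromℕ (middle n) ≡ fromℕ (La P n)
  ratio*middle n = /-*-cancel (La P n) (middle n) {{nCk-nonZero (⌊n/2⌋≤n n)}}
  ratio< : ∀ n → N ≤ n → La-ratio P n ℚ.* fromℕ (middle n) ℚ.< (fromℕ e ℚ.+ ε) ℚ.* fromℕ (middle n)
  ratio< n N≤n = begin-strict
    La-ratio P n ℚ.* fromℕ M               ≡⟨ ratio*middle n ⟩
    fromℕ (La P n)
      <⟨ proj₂ eventually n (≤-trans (≤-trans (m≤m+n N₁ N₂) (m≤m+n _ _)) N≤n) 2d≤ ⟩
    (fromℕ e ℚ.+ δ ℚ.+ δ) ℚ.* fromℕ M      ≡⟨ cong (ℚ._* fromℕ M) (ℚₚ.+-assoc (fromℕ e) δ δ) ⟩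
    (fromℕ e ℚ.+ (δ ℚ.+ δ)) ℚ.* fromℕ M    ≡⟨ cong (λ x → (fromℕ e ℚ.+ x) ℚ.* fromℕ M) δ+δ≡ε ⟩
    (fromℕ e ℚ.+ ε) ℚ.* fromℕ M            ∎
    where
    M = middle n
    2d≤ : 2 * ↧ₙ δ ≤ n / 12
    2d≤ = subst (_≤ n / 12) (m*n/n≡m (2 * ↧ₙ δ) 12)
      (/-mono-≤ {o = 12} (≤-trans (≤-trans (m≤n+m N₂ N₁) (m≤m+n _ _)) N≤n) ≤-refl)
  ratio> : ∀ n → N ≤ n → fromℕ e ℚ.* fromℕ (middle n) ℚ.< (La-ratio P n ℚ.+ ε) ℚ.* fromℕ (middle n)
  ratio> n N≤n = begin-strict
    fromℕ e ℚ.* fromℕ M                             <⟨ La-eventually-≥ P isE ε 0<ε n N₃≤ ⟩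
    fromℕ (La P n) ℚ.+ ε ℚ.* fromℕ M                ≡⟨ cong (ℚ._+ ε ℚ.* fromℕ M) (ratio*middle n) ⟨
    La-ratio P n ℚ.* fromℕ M ℚ.+ ε ℚ.* fromℕ M      ≡⟨ ℚₚ.*-distribʳ-+ (fromℕ M) (La-ratio P n) ε ⟨
    (La-ratio P n ℚ.+ ε) ℚ.* fromℕ M                ∎
    where
    M = middle n
    N₃≤ : N₃ ≤ ⌊ n /2⌋
    N₃≤ = subst (_≤ ⌊ n /2⌋) (sym (n≡⌊n+n/2⌋ N₃)) (⌊n/2⌋-mono (≤-trans (m≤n+m _ (N₁ + N₂)) N≤n))
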